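{- None of the logics $\mathsf{QC2^v_{\mathit{E}}}$, $\mathsf{QC2^v_=}$, $\mathsf{QC2^c_{\mathit{E}}}$, $\mathsf{QC2^c_=}$ is the logic of any class of selection frames; that is, for each such logic $\mathsf{L}$ (in its language $\mathcal{L}_E$ or $\mathcal{L}_=$) there is no class $\mathcal{C}$ of selection frames such that the set of theorems of $\mathsf{L}$ equals the set of formulas of its language valid in every frame of $\mathcal{C}$.
   Context: Languages: countably many variables, for each $n$ countably many $n$-place predicates; formulas $\phi ::= P^n(x_1,\dots,x_n)\mid\neg\phi\mid(\phi\supset\phi)\mid(\phi>\phi)\mid\forall x\phi$; $\mathcal{L}_E$ adds a unary existence predicate $E$; $\mathcal{L}_=$ adds a binary identity predicate $=$, and in $\mathcal{L}_=$, $E(x)$ abbreviates $\exists y(x=y)$. $\wedge,\vee,\equiv,\top,\bot,\exists$ defined as usual; $\Box\phi:=(\neg\phi>\bot)$, $\Diamond\phi:=\neg(\phi>\bot)$; $\phi[y/x]$ is capture-avoiding substitution; $\vec\alpha>\phi$ denotes $\alpha_1>(\alpha_2>(\cdots>(\alpha_n>\phi)\cdots))$ (just $\phi$ if $n=0$). $\mathsf{QC2^v_{\mathit{E}}}$ (in $\mathcal{L}_E$) is the set of formulas derivable from: (A1) substitution instances of propositional tautologies; (A2) $\phi>\phi$; (A3) $((\phi>\psi)\wedge(\psi>\phi)\wedge(\phi>\chi))\supset(\psi>\chi)$; (A4) $(\phi>\psi)\supset(\phi\supset\psi)$; (A5) $(\phi>\psi)\vee(\phi>\neg\psi)$; (A6v)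 $(\forall x\phi\wedge E(y))\supset\phi[y/x]$; (A7) $\forall x(\phi>\psi)\supset(\phi>\forall x\psi)$ where $x$ is not free in $\phi$; rules (R1) from $\phi$ and $\phi\supset\psi$ infer $\psi$; (R2) from $(\psi_1\wedge\cdots\wedge\psi_n)\supset\chi$ infer $((\phi>\psi_1)\wedge\cdots\wedge(\phi>\psi_n))\supset(\phi>\chi)$; (R3v) from $\psi\supset(\vec\alpha>(E(y)\supset\phi[y/x]))$, where $y$ is not free in $\alpha_1,\dots,\alpha_n$, $\psi$, or $\forall x\phi$, infer $\psi\supset(\vec\alpha>\forall x\phi)$. $\mathsf{QC2^c_{\mathit{E}}}$ adds the axioms $E(x)\supset\Box E(x)$ and $\neg E(x)\supset\Box\neg E(x)$. $\mathsf{QC2^v_=}$ and $\mathsf{QC2^c_=}$ (in $\mathcal{L}_=$) are obtained from $\mathsf{QC2^v_{\mathit{E}}}$ and $\mathsf{QC2^c_{\mathit{E}}}$ by adding (I1) $x=x$; (I2) $x=y\supset(\phi\equiv\phi[y/x])$; (I3) $x\neq y\supset\Box x\neq y$. A selection frame is $\langle W,R,f,D,d\rangle$ with $W\neq\varnothing$, $R\subseteq W\times W$, $f:\mathcal{P}(W)\times W\to\mathcal{P}(W)$ with $f(P,w)\subseteq R(w):=\{v:wRv\}$, $D\neq\varnothing$, $d:W\to\mathcal{P}(D)$ (possibly empty). A model adds $I$ with $I(P^n,w)\subseteq D^n$ for non-logical predicates. With assignments $g$ from variables to $D$: atomic clauses via $I$; $w,g\Vdash E(x)$ iff $g(x)\in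 d(w)$; $w,g\Vdash x=y$ iff $g(x)=g(y)$; $\neg,\supset$ classical; $w,g\Vdash\forall x\phi$ iff $w,g^x_a\Vdash\phi$ for all $a\in d(w)$; $w,g\Vdash\phi>\psi$ iff $f([\phi]^g,w)\subseteq[\psi]^g$, $[\phi]^g=\{v:v,g\Vdash\phi\}$. Validity in a frame: truth at all worlds, all assignments, all models on the frame; in a class: in every frame of it. -}

module Defs where

open import Level using (Level; _⊔_; Setω) renaming (suc to lsuc)
open import Data.Nat using (ℕ; zero; suc; _≡ᵇ_) renaming (_⊔_ to _⊔ℕ_)
open import Data.Bool using (Bool; true; false; if_then_else_; not; _∧_; _∨_)
open import Data.List using (List; []; _∷_; _++_; map; foldr; filterᵇ)
open import Data.Bool.ListAction using (any)
open import Data.List.Membership.Propositional using (_∉_)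
open import Data.List.Relation.Unary.All using (All)
open import Data.Vec using (Vec; toList) renaming (map to vmap)
open import Data.Product using (Σ; _×_; _,_)
open import Relation.Nullary using (¬_; Dec)
open import Relation.Binary.PropositionalEquality using (_≡_)
open import Function.Bundles using (_⇔_)

Var : Set
Var = ℕ

data Lang : Set where
  LE LEq : Lang

-- P n k xs : the k-th n-place (non-logical) predicate applied to xs
data Fm : Lang → Set where
  P    : ∀ {L} (n k : ℕ) → Vec Var n → Fm L
  E    : Var → Fm LE
  _≐_  : Var → Var → Fm LEq
  ~_   : ∀ {L} → Fm L → Fm L
  _⊃_  : ∀ {L} → Fm L → Fm L → Fm L
  _▷_  : ∀ {L} → Fm L → Fm L → Fm L
  ∀'   : ∀ {L} → Var → Fm L → Fm L

infixr 5 _⊃_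
infixr 6 _▷_
infix 8 ~_

module _ {L : Lang} where
  _∧'_ : Fm L → Fm L → Fm L
  φ ∧' ψ = ~ (φ ⊃ ~ ψ)

  _∨'_ : Fm L → Fm L → Fm L
  φ ∨' ψ = ~ φ ⊃ ψ

  _≡'_ : Fm L → Fm L → Fm L
  φ ≡' ψ = (φ ⊃ ψ) ∧' (ψ ⊃ φ)

  ⊤' : Fm L
  ⊤' = P 0 0 Data.Vec.[] ⊃ P 0 0 Data.Vec.[]

  ⊥' : Fm L
  ⊥' = ~ ⊤'

  ∃' : Var → Fm L → Fm L
  ∃' x φ = ~ ∀' x (~ φ)

  □ : Fm L → Fm L
  □ φ = ~ φ ▷ ⊥'

  ◇ : Fm L → Fm L
  ◇ φ = ~ (φ ▷ ⊥')

  ⋀⁺ : Fm L → List (Fm L) → Fm L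
  ⋀⁺ ψ [] = ψ
  ⋀⁺ ψ (ψ' ∷ ψs) = ψ ∧' ⋀⁺ ψ' ψs

  _▷*_ : List (Fm L) → Fm L → Fm L
  [] ▷* φ = φ
  (α ∷ αs) ▷* φ = α ▷ (αs ▷* φ)

-- existence: primitive in 𝓛_E; in 𝓛_= E(x) abbreviates ∃y(x = y), y := suc x (≠ x)
Ex : (L : Lang) → Var → Fm L
Ex LE  x = E x
Ex LEq x = ∃' (suc x) (x ≐ suc x)

fv : ∀ {L} → Fm L → List Var
fv (P n k xs) = toList xs
fv (E x) = x ∷ []
fv (x ≐ y) = x ∷ y ∷ []
fv (~ φ) = fv φ
fv (φ ⊃ ψ) = fv φ ++ fv ψ
fv (φ ▷ ψ) = fv φ ++ fv ψ
fv (∀' x φ) = filterᵇ (λ u → not (u ≡ᵇ x)) (fv φ)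

upd : (Var → Var) → Var → Var → (Var → Var)
upd σ x z u = if u ≡ᵇ x then z else σ u

maxL : List ℕ → ℕ
maxL = foldr _⊔ℕ_ 0

-- capture-avoiding simultaneous substitution of variables for variables;
-- a bound variable is renamed (to a fresh one) only when it would capture.
sub : ∀ {L} → (Var → Var) → Fm L → Fm L
sub σ (P n k xs) = P n k (vmap σ xs)
sub σ (E x) = E (σ x)
sub σ (x ≐ y) = σ x ≐ σ y
sub σ (~ φ) = ~ sub σ φ
sub σ (φ ⊃ ψ) = sub σ φ ⊃ sub σ ψ
sub σ (φ ▷ ψ) = sub σ φ ▷ sub σ ψ
sub σ (∀' x φ) = ∀' z (sub (upd σ x z) φ)
  where
  avoid : List Var
  avoid = map σ (fv (∀' x φ))
  z : Var
  z = if any (λ u → u ≡ᵇ x) avoid then suc (maxL avoid) else x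

_[_/_] : ∀ {L} → Fm L → Var → Var → Fm L
φ [ y / x ] = sub (upd (λ u → u) x y) φ

data PF : Set where
  atom : ℕ → PF
  pneg : PF → PF
  pimp : PF → PF → PF

evalP : (ℕ → Bool) → PF → Bool
evalP v (atom i) = v i
evalP v (pneg p) = not (evalP v p)
evalP v (pimp p q) = not (evalP v p) ∨ evalP v q

Tautology : PF → Set
Tautology p = ∀ v → evalP v p ≡ true

inst : ∀ {L} → (ℕ → Fm L) → PF → Fm L
inst s (atom i) = s i
inst s (pneg p) = ~ inst s p
inst s (pimp p q) = inst s p ⊃ inst s q

-- The logics QC2^v_E (LE, vary), QC2^c_E (LE, const),
--            QC2^v_= (LEq, vary), QC2^c_= (LEq, const)

data Variant : Set where
  vary const : Variant

data Thm : (L : Lang) → Variant → Fm L → Set where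
  A1  : ∀ {L k} (p : PF) (s : ℕ → Fm L) → Tautology p → Thm L k (inst s p)
  A2  : ∀ {L k} (φ : Fm L) → Thm L k (φ ▷ φ)
  A3  : ∀ {L k} (φ ψ χ : Fm L) →
        Thm L k ((((φ ▷ ψ) ∧' (ψ ▷ φ)) ∧' (φ ▷ χ)) ⊃ (ψ ▷ χ))
  A4  : ∀ {L k} (φ ψ : Fm L) → Thm L k ((φ ▷ ψ) ⊃ (φ ⊃ ψ))
  A5  : ∀ {L k} (φ ψ : Fm L) → Thm L k ((φ ▷ ψ) ∨' (φ ▷ ~ ψ))
  A6v : ∀ {L k} (x y : Var) (φ : Fm L) →
        Thm L k ((∀' x φ ∧' Ex L y) ⊃ (φ [ y / x ]))
  A7  : ∀ {L k} (x : Var) (φ ψ : Fm L) → x ∉ fv φ →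
        Thm L k (∀' x (φ ▷ ψ) ⊃ (φ ▷ ∀' x ψ))
  R1  : ∀ {L k} {φ ψ : Fm L} → Thm L k φ → Thm L k (φ ⊃ ψ) → Thm L k ψ
  R2  : ∀ {L k} (φ ψ : Fm L) (ψs : List (Fm L)) (χ : Fm L) →
        Thm L k (⋀⁺ ψ ψs ⊃ χ) →
        Thm L k (⋀⁺ (φ ▷ ψ) (map (φ ▷_) ψs) ⊃ (φ ▷ χ))
  R3v : ∀ {L k} (ψ : Fm L) (αs : List (Fm L)) (x y : Var) (φ : Fm L) →
        All (λ α → y ∉ fv α) αs → y ∉ fv ψ → y ∉ fv (∀' x φ) →
        Thm L k (ψ ⊃ (αs ▷* (Ex L y ⊃ (φ [ y / x ])))) →
        Thm L k (ψ ⊃ (αs ▷* ∀' x φ))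
  C1  : ∀ {L} (x : Var) → Thm L const (Ex L x ⊃ □ (Ex L x))
  C2  : ∀ {L} (x : Var) → Thm L const (~ Ex L x ⊃ □ (~ Ex L x))
  I1  : ∀ {k} (x : Var) → Thm LEq k (x ≐ x)
  I2  : ∀ {k} (x y : Var) (φ : Fm LEq) → Thm LEq k ((x ≐ y) ⊃ (φ ≡' (φ [ y / x ])))
  I3  : ∀ {k} (x y : Var) → Thm LEq k (~ (x ≐ y) ⊃ □ (~ (x ≐ y)))

-- Semantics: selection frames.  Subsets of W are predicates W → Set ℓ;
-- since f acts on *sets*, f is required to be extensional.

record Frame (ℓ : Level) : Set (lsuc ℓ) where
  field
    W    : Set ℓ
    w₀   : W                                   -- W ≠ ∅
    R    : W → W → Set ℓ
    f    : (W → Set ℓ) → W → (W → Set ℓ)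
    f⊆R  : ∀ X w v → f X w v → R w v
    f-ext : ∀ X Y w → (∀ v → X v ⇔ Y v) → ∀ v → f X w v ⇔ f Y w v
    D    : Set ℓ
    a₀   : D                                   -- D ≠ ∅
    d    : W → D → Set ℓ                       -- d(w) ⊆ D, possibly empty

module _ {ℓ : Level} (F : Frame ℓ) where
  open Frame F

  Interp : Set (lsuc ℓ)
  Interp = (n k : ℕ) → W → Vec D n → Set ℓ

  updA : (Var → D) → Var → D → (Var → D)
  updA g x a u = if u ≡ᵇ x then a else g u

  sat : ∀ {L} → Interp → W → (Var → D) → Fm L → Set ℓ
  sat I w g (P n k xs) = I n k w (vmap g xs)
  sat I w g (E x) = d w (g x)
  sat I w g (x ≐ y) = g x ≡ g y
  sat I w g (~ φ) = ¬ sat I w g φ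
  sat I w g (φ ⊃ ψ) = sat I w g φ → sat I w g ψ
  sat I w g (φ ▷ ψ) = ∀ v → f (λ u → sat I u g φ) w v → sat I v g ψ
  sat I w g (∀' x φ) = ∀ a → d w a → sat I w (updA g x a) φ

  ValidInFrame : ∀ {L} → Fm L → Set (lsuc ℓ)
  ValidInFrame φ = ∀ (I : Interp) (w : W) (g : Var → D) → sat I w g φ

FrameClass : (ℓ ℓ' : Level) → Set (lsuc ℓ ⊔ lsuc ℓ')
FrameClass ℓ ℓ' = Frame ℓ → Set ℓ'

ValidIn : ∀ {ℓ ℓ' L} → FrameClass ℓ ℓ' → Fm L → Set (lsuc ℓ ⊔ ℓ')
ValidIn C φ = ∀ F → C F → ValidInFrame F φ

IsLogicOf : ∀ {ℓ ℓ'} (L : Lang) (k : Variant) → FrameClass ℓ ℓ' → Set (lsuc ℓ ⊔ ℓ')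
IsLogicOf L k C = ∀ (φ : Fm L) → Thm L k φ ⇔ ValidIn C φ

-- classical metatheory (the paper reasons classically)
ExcludedMiddle : Setω
ExcludedMiddle = ∀ {a} (A : Set a) → Dec A

{-# OPTIONS --safe #-}

-- A selection frame validating A2, A3 and A5 orders the worlds accessible from w so that every
-- nonempty set of them, definable or not, has a least element.  Hence no family of propositions
-- Pa, indexed by the a that exist and satisfy Q at w, can descend forever, and this is expressed
-- by the formula `noDescent`.  It is not a theorem: in the model below the points seen from `base`
-- form a copy of ω + ω*, one for each object, and Q singles out the ω* part at `base` only.  At the
-- points themselves all objects but one look alike, so a definable set contains finitely or
-- cofinitely many points and does have a least element, which is all the axioms need.
module Submission where

open import Defs
open import Level using (Level; 0ℓ)
open import Data.Bool using (true; false; not; if_then_else_; T; T?)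
open import Data.Bool.ListAction using (any)
open import Data.Empty using (⊥-elim)
import Data.Empty.Polymorphic as Poly
open import Data.List using (List; []; _∷_; map)
open import Data.List.Membership.Propositional using (_∈_; _∉_)
open import Data.List.Membership.Propositional.Properties using (∈-++⁺ˡ; ∈-++⁺ʳ; ∈-filter⁺; ∈-map⁺)
open import Data.List.Relation.Unary.All using (All; []; _∷_)
open import Data.List.Relation.Unary.Any using (here; there)
open import Data.Nat using (ℕ; zero; suc; _≤_; _<_; _≡ᵇ_; _≟_; s≤s⁻¹)
open import Data.Nat.Induction using (<-rec)
open import Data.Nat.Properties using (≤-refl; ≤-trans; ≤-antisym;
  m≤m⊔n; m≤n⊔m; ≮⇒≥; ≰⇒>; ≤∧≢⇒<; 1+n≰n; 1+n≢n)
open import Data.Product using (Σ; _×_; _,_; proj₁)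
open import Data.Unit using (⊤; tt)
open import Data.Vec using (Vec; []; _∷_; toList) renaming (map to vmap)
open import Data.Vec.Properties using (map-∘)
open import Function using (_∘_; case_of_; _⇔_; mk⇔; Equivalence)
open import Function.Properties.Equivalence using () renaming (sym to ⇔-sym)
open import Relation.Binary.PropositionalEquality using (_≡_; _≢_; refl; sym; trans; cong; cong₂; subst)
open import Relation.Nullary using (¬_; yes; no; does; Reflects; invert; proof; contradiction)
open import Relation.Nullary.Decidable using (dec-true; dec-false; decidable-stable)
open import Relation.Nullary.Reflects using (¬-reflects; _→-reflects_)
open import Relation.Unary using (Pred; _⊆′_)

open Equivalence using (to; from)

private
  variable
    ℓ : Level
    A : Set ℓ
    L : Lang
    k : Variant

-- Variables and substitution

if-≡ : ∀ u {a b : A} → (if u ≡ᵇ u then a else b) ≡ a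
if-≡ u rewrite dec-true (u ≟ u) refl = refl

if-≢ : ∀ {u x} {a b : A} → u ≢ x → (if u ≡ᵇ x then a else b) ≡ b
if-≢ {u = u} {x} u≢x rewrite dec-false (u ≟ x) u≢x = refl

∈⇒≤maxL : ∀ {u us} → u ∈ us → u ≤ maxL us
∈⇒≤maxL {us = v ∷ vs} (here refl) = m≤m⊔n v (maxL vs)
∈⇒≤maxL {us = v ∷ vs} (there u∈) = ≤-trans (∈⇒≤maxL u∈) (m≤n⊔m v (maxL vs))

any-≡ᵇ : ∀ {x us} → x ∈ us → any (λ u → u ≡ᵇ x) us ≡ true
any-≡ᵇ {x} (here refl) rewrite dec-true (x ≟ x) refl = refl
any-≡ᵇ {x} {v ∷ vs} (there x∈) with v ≡ᵇ x
... | true  = refl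
... | false = any-≡ᵇ x∈

-- The right-hand side is the binder that `sub` picks, so no image of a free variable gets captured:
-- either it exceeds everything in `us`, or it is `x` and `x` does not occur there.
∈⇒≢fresh : ∀ {u x us} → u ∈ us → u ≢ (if any (λ v → v ≡ᵇ x) us then suc (maxL us) else x)
∈⇒≢fresh {u} {x} {us} u∈ u≡z with any (λ v → v ≡ᵇ x) us in eq
... | true  = 1+n≰n (subst (_≤ maxL us) u≡z (∈⇒≤maxL u∈))
... | false with () ← trans (sym eq) (any-≡ᵇ (subst (_∈ us) u≡z u∈))

∈fv-∀ : ∀ {u} x (φ : Fm L) → u ∈ fv φ → u ≢ x → u ∈ fv (∀' x φ)
∈fv-∀ {u = u} x φ u∈ u≢x =
  ∈-filter⁺ (λ v → T? (not (v ≡ᵇ x))) u∈ (subst (T ∘ not) (sym (dec-false (u ≟ x) u≢x)) tt)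

vmap-cong-∈ : ∀ {B : Set ℓ} {n} (xs : Vec Var n) {g h : Var → B} →
              (∀ {u} → u ∈ toList xs → g u ≡ h u) → vmap g xs ≡ vmap h xs
vmap-cong-∈ []       eq = refl
vmap-cong-∈ (x ∷ xs) eq = cong₂ _∷_ (eq (here refl)) (vmap-cong-∈ xs (eq ∘ there))

module _ (F : Frame ℓ) (I : Interp F) where
  open Frame F

  -- Asking for agreement on free variables only lets the induction pass under a renamed binder.
  sat-sub : (φ : Fm L) {σ : Var → Var} {g h : Var → D} →
            (∀ {u} → u ∈ fv φ → h u ≡ g (σ u)) →
            ∀ w → sat F I w g (sub σ φ) ⇔ sat F I w h φ
  sat-sub (P n k xs) {σ} {g} {h} eq w = mk⇔ (subst (I n k w) (sym vs)) (subst (I n k w) vs)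
    where
    vs : vmap h xs ≡ vmap g (vmap σ xs)
    vs = trans (vmap-cong-∈ xs eq) (map-∘ g σ xs)
  sat-sub (E x) eq w = mk⇔ (subst (d w) (sym (eq (here refl)))) (subst (d w) (eq (here refl)))
  sat-sub (x ≐ y) eq w = mk⇔
    (λ p → trans (eq (here refl)) (trans p (sym (eq (there (here refl))))))
    (λ p → trans (sym (eq (here refl))) (trans p (eq (there (here refl)))))
  sat-sub (~ φ) eq w = mk⇔ (_∘ from ih) (_∘ to ih)
    where ih = sat-sub φ eq w
  sat-sub (φ ⊃ ψ) eq w = mk⇔ (λ p → to ihψ ∘ p ∘ from ihφ) (λ p → from ihψ ∘ p ∘ to ihφ)
    where
    ihφ = sat-sub φ (eq ∘ ∈-++⁺ˡ) w
    ihψ = sat-sub ψ (eq ∘ ∈-++⁺ʳ (fv φ)) w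
  sat-sub (φ ▷ ψ) eq w = mk⇔
    (λ p v → to (ihψ v) ∘ p v ∘ from (ihf v))
    (λ p v → from (ihψ v) ∘ p v ∘ to (ihf v))
    where
    ihf = f-ext _ _ w (sat-sub φ (eq ∘ ∈-++⁺ˡ))
    ihψ = sat-sub ψ (eq ∘ ∈-++⁺ʳ (fv φ))
  sat-sub (∀' x φ) {σ} {g} {h} eq w = mk⇔
    (λ p a da → to (sat-sub φ (eq′ a) w) (p a da))
    (λ p a da → from (sat-sub φ (eq′ a) w) (p a da))
    where
    avoid : List Var
    avoid = map σ (fv (∀' x φ))
    z : Var
    z = if any (λ u → u ≡ᵇ x) avoid then suc (maxL avoid) else x
    eq′ : ∀ a {u} → u ∈ fv φ → updA F h x a u ≡ updA F g z a (upd σ x z u)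
    eq′ a {u} u∈ with u ≟ x
    ... | yes refl = trans (if-≡ u) (sym (trans (cong (updA F g z a) (if-≡ u)) (if-≡ z)))
    ... | no u≢x   = trans (if-≢ u≢x) (trans (eq u∈∀) (sym (trans
            (cong (updA F g z a) (if-≢ u≢x)) (if-≢ (∈⇒≢fresh (∈-map⁺ σ u∈∀))))))
      where u∈∀ = ∈fv-∀ x φ u∈ u≢x

  -- Both sides are equivalent to the instance of the identity substitution.
  sat-cong : (φ : Fm L) {g h : Var → D} → (∀ {u} → u ∈ fv φ → h u ≡ g u) →
             ∀ w → sat F I w g φ ⇔ sat F I w h φ
  sat-cong φ {g} {h} eq w = mk⇔ (to sub⇔h ∘ from sub⇔g) (to sub⇔g ∘ from sub⇔h)
    where
    sub⇔g : sat F I w g (sub (λ u → u) φ) ⇔ sat F I w g φ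
    sub⇔g = sat-sub φ (λ _ → refl) w
    sub⇔h : sat F I w g (sub (λ u → u) φ) ⇔ sat F I w h φ
    sub⇔h = sat-sub φ eq w

  sat-updA-fresh : (φ : Fm L) {g : Var → D} {x : Var} {a : D} → x ∉ fv φ →
                   ∀ w → sat F I w g φ ⇔ sat F I w (updA F g x a) φ
  sat-updA-fresh φ {x = x} x∉ = sat-cong φ (λ {u} u∈ → if-≢ {u = u} {x} (λ { refl → x∉ u∈ }))

  sat-Ex : ∀ L {w} {g : Var → D} x → d w (g x) → sat F I w g (Ex L x)
  sat-Ex LE  x dx = dx
  sat-Ex LEq x dx none = none _ dx (trans (if-≢ {u = x} {suc x} (1+n≢n ∘ sym)) (sym (if-≡ (suc x))))

-- The separating formula

-- `(S 0 ∨' S 1) ▷ ~ S 0` encodes strict descent from object 0 to object 1; `S 0 ▷ ⊥'` says that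
-- `S 0` selects no world.
noDescent : Fm L
noDescent = ∀' 0 (Q 0 ⊃ ∃' 1 (Q 1 ∧' ((S 0 ∨' S 1) ▷ ~ S 0))) ⊃ ∀' 0 (Q 0 ⊃ (S 0 ▷ ⊥'))
  where
  S Q : Var → Fm _
  S x = P 1 0 (x ∷ [])
  Q x = P 1 1 (x ∷ [])

module _ (em : ExcludedMiddle) (F : Frame ℓ) where
  open Frame F

  -- Let `X` be the union of the `S b` over the existing Q-objects. A world selected from `X` lies
  -- in some `S b`, and `single` then puts the whole selection there. Descent supplies `c`, and
  -- `cumulative` carries this over to `S b ∪ S c`, whose selection avoids `S b`. So that selection
  -- is empty, and by `cumulative` again so is that of `X`.
  noDescent-valid :
    (∀ (X : Pred W ℓ) w → f X w ⊆′ X) →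
    (∀ (X Y Z : Pred W ℓ) w → f X w ⊆′ Y → f Y w ⊆′ X → f X w ⊆′ Z → f Y w ⊆′ Z) →
    (∀ (X Y : Pred W ℓ) w → ¬ (f X w ⊆′ Y) → f X w ⊆′ (λ v → ¬ Y v)) →
    ValidInFrame F (noDescent {L})
  noDescent-valid success cumulative single I w g descends a da qa v₀ fv₀ _ =
    Poly.⊥-elim (cumulative X (S a) ∅ w
      (λ v → ⊥-elim ∘ X-empty v)
      (λ v fv → a , da , qa , success (S a) w v fv)
      (λ v → ⊥-elim ∘ X-empty v) v₀ fv₀)
    where
    ∅ : Pred W ℓ
    ∅ _ = Poly.⊥
    S : D → Pred W ℓ
    S b v = I 1 0 v (b ∷ [])
    Q : D → Set ℓ
    Q b = I 1 1 w (b ∷ [])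
    X : Pred W ℓ
    X v = Σ D λ b → d w b × Q b × S b v
    X-empty : ∀ v → ¬ f X w v
    X-empty v fv with success X w v fv
    ... | b , db , qb , sbv = descends b db qb λ c dc none → none λ qc selects →
      let
        -- This is `S b ∪ S c` in the shape to which `∨'` unfolds, so `selects` speaks of it
        -- directly.
        Y = λ u → ¬ S b u → S c u
        fX⊆Sb : f X w ⊆′ S b
        fX⊆Sb = decidable-stable (em _) λ fX⊈Sb → single X (S b) w fX⊈Sb v fv sbv
        fX⊆Y : f X w ⊆′ Y
        fX⊆Y u fu ¬sb = ⊥-elim (¬sb (fX⊆Sb u fu))
        fY⊆X : f Y w ⊆′ X
        fY⊆X u fu = case em (S b u) of λ where
          (yes sb) → b , db , qb , sb
          (no ¬sb) → c , dc , qc , success Y w u fu ¬sb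
        fY⊆∅ : f Y w ⊆′ ∅
        fY⊆∅ u fu = ⊥-elim (selects u fu (cumulative X Y (S b) w fX⊆Y fY⊆X fX⊆Sb u fu))
      in Poly.⊥-elim (cumulative Y X ∅ w fY⊆X fX⊆Y fY⊆∅ v fv)

-- Zero-place atoms can denote arbitrary sets of worlds, so a single atomic instance of each of A2,
-- A3 and A5 yields a frame condition on all sets.
IsLogicOf⇒noDescent-valid : ∀ {ℓ′} {C : FrameClass ℓ ℓ′} → ExcludedMiddle →
                            IsLogicOf L k C → ValidIn C (noDescent {L})
IsLogicOf⇒noDescent-valid {ℓ = ℓ} {L = L} {k = k} em logic F F∈C = noDescent-valid em F {L = L}
  (λ X w → valid (A2 p₀) X X X w)
  (λ X Y Z w X⊆Y Y⊆X X⊆Z → valid (A3 p₀ p₁ p₂) X Y Z w λ ¬c → ¬c (λ ¬c′ → ¬c′ X⊆Y Y⊆X) X⊆Z)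
  (λ X Y w → valid (A5 p₀ p₁) X Y Y w)
  where
  open Frame F
  p₀ p₁ p₂ : Fm L
  p₀ = P 0 0 []
  p₁ = P 0 1 []
  p₂ = P 0 2 []
  interp : (X Y Z : Pred W ℓ) → Interp F
  interp X Y Z n 0 v _ = X v
  interp X Y Z n 1 v _ = Y v
  interp X Y Z n _ v _ = Z v
  valid : ∀ {φ : Fm L} → Thm L k φ → ∀ X Y Z w → sat F (interp X Y Z) w (λ _ → a₀) φ
  valid ⊢φ X Y Z w = to (logic _) ⊢φ F F∈C (interp X Y Z) w (λ _ → a₀)

-- The countermodel

data Obj : Set where
  near far : ℕ → Obj

data World : Set where
  base : World
  pt   : Obj → World

-- Larger indices lie lower among the far points, which makes them the ω* part. With `base` at the
-- bottom, A4 holds there.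
data _≼_ : World → World → Set where
  base≼     : ∀ {w} → base ≼ w
  near≼near : ∀ {m n} → m ≤ n → pt (near m) ≼ pt (near n)
  near≼far  : ∀ {m n} → pt (near m) ≼ pt (far n)
  far≼far   : ∀ {m n} → n ≤ m → pt (far m) ≼ pt (far n)

≼-refl : ∀ {w} → w ≼ w
≼-refl {base}        = base≼
≼-refl {pt (near _)} = near≼near ≤-refl
≼-refl {pt (far _)}  = far≼far ≤-refl

≼-antisym : ∀ {v w} → v ≼ w → w ≼ v → v ≡ w
≼-antisym base≼ base≼ = refl
≼-antisym (near≼near p) (near≼near q) = cong (pt ∘ near) (≤-antisym p q)
≼-antisym (far≼far p) (far≼far q) = cong (pt ∘ far) (≤-antisym q p)

-- A point sees only itself, so formulas evaluated at points cannot detect the order.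
data _sees_ : World → World → Set where
  from-base : ∀ {w} → base sees w
  itself    : ∀ {p} → pt p sees pt p

sees-refl : ∀ {w} → w sees w
sees-refl {base} = from-base
sees-refl {pt _} = itself

sees⇒≼ : ∀ {w v} → w sees v → w ≼ v
sees⇒≼ from-base = base≼
sees⇒≼ itself    = ≼-refl

-- Empty when X has no least element among the worlds seen from w.
least : Pred World 0ℓ → World → Pred World 0ℓ
least X w v = w sees v × X v × (∀ u → w sees u → X u → v ≼ u)

least-cong : ∀ {X Y} w → (∀ v → X v ⇔ Y v) → least X w ⊆′ least Y w
least-cong w X⇔Y v (wv , xv , v-min) = wv , to (X⇔Y v) xv , λ u wu yu → v-min u wu (from (X⇔Y u) yu)

-- Every object exists at every world, so one frame serves the varying and the constant logics
-- alike.
𝔽 : Frame 0ℓ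
𝔽 = record
  { W = World ; w₀ = base ; R = _sees_
  ; f = least
  ; f⊆R = λ _ _ _ → proj₁
  ; f-ext = λ X Y w X⇔Y v → mk⇔ (least-cong w X⇔Y v) (least-cong w (⇔-sym ∘ X⇔Y) v)
  ; D = Obj ; a₀ = near 0 ; d = λ _ _ → ⊤
  }

-- `S a` isolates the world `pt a`. `Q` is confined to `base`, so it cannot separate near from far
-- objects at the points.
data 𝕀 : Interp 𝔽 where
  own : ∀ {p a} → a ≡ p → 𝕀 1 0 (pt p) (a ∷ [])
  far : ∀ {m} → 𝕀 1 1 base (far m ∷ [])

infix 4 _,_⊩_
_,_⊩_ : World → (Var → Obj) → Fm L → Set
w , g ⊩ φ = sat 𝔽 𝕀 w g φ

noDescent-fails : ∀ g → ¬ (base , g ⊩ noDescent {L})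
noDescent-fails g holds =
  holds descends (far 0) tt far (pt (far 0))
    (from-base , own refl , λ { _ _ (own refl) → ≼-refl }) (λ x → x)
  where
  descends : ∀ a → ⊤ → 𝕀 1 1 base (a ∷ []) → _
  -- The next far point is strictly lower, so `pt (far m)` is not the least of the two.
  descends .(far m) _ (far {m}) none = none (far (suc m)) tt λ selects → selects far λ where
    _ (_ , _ , v-min) (own refl) →
      case v-min (pt (far (suc m))) from-base (λ _ → own refl) of λ { (far≼far le) → 1+n≰n le }

-- Definable sets of points

index : Obj → ℕ
index (near n) = n
index (far n)  = n

-- Since `index` forgets the half, the condition ties the tail of the near points to that of the far
-- points.
EventuallyConstant : Pred World 0ℓ → Set
EventuallyConstant X =
  Σ ℕ λ K → ∀ {p q} → K ≤ index p → K ≤ index q → X (pt p) → X (pt q)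

▷-pt : ∀ (φ ψ : Fm L) {p g} → (pt p , g ⊩ φ ▷ ψ) ⇔ (pt p , g ⊩ φ ⊃ ψ)
▷-pt φ ψ {p} = mk⇔
  (λ h x → h (pt p) (itself , x , λ { _ itself _ → ≼-refl }))
  (λ { h _ (itself , x , _) → h x })

module _ (π : Obj → Obj) (π-involutive : ∀ a → π (π a) ≡ a) where

  π-sym : ∀ {a b} → b ≡ π a → a ≡ π b
  π-sym refl = sym (π-involutive _)

  -- At a point the conditional is material, and the only non-logical predicate with instances is
  -- identity with the point's own object, so every permutation of objects is a symmetry. For an
  -- involution, the negative cases are the same statement with the two sides swapped.
  ⊩-automorphic : (φ : Fm L) {g h : Var → Obj} → (∀ {u} → u ∈ fv φ → h u ≡ π (g u)) →
                  ∀ {p q} → q ≡ π p → pt p , g ⊩ φ → pt q , h ⊩ φ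
  ⊩-automorphic (P n k xs) {g} {h} eq refl s = subst (𝕀 n k _) (sym vs) (𝕀-π s)
    where
    𝕀-π : ∀ {n k p v} → 𝕀 n k (pt p) v → 𝕀 n k (pt (π p)) (vmap π v)
    𝕀-π (own a≡p) = own (cong π a≡p)
    vs : vmap h xs ≡ vmap π (vmap g xs)
    vs = trans (vmap-cong-∈ xs eq) (map-∘ π g xs)
  ⊩-automorphic (E x) eq pq s = tt
  ⊩-automorphic (x ≐ y) eq pq s =
    trans (eq (here refl)) (trans (cong π s) (sym (eq (there (here refl)))))
  ⊩-automorphic (~ φ) eq pq s t = s (⊩-automorphic φ (λ u∈ → π-sym (eq u∈)) (π-sym pq) t)
  ⊩-automorphic (φ ⊃ ψ) eq pq s t =
    ⊩-automorphic ψ (λ u∈ → eq (∈-++⁺ʳ (fv φ) u∈)) pq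
      (s (⊩-automorphic φ (λ u∈ → π-sym (eq (∈-++⁺ˡ u∈))) (π-sym pq) t))
  ⊩-automorphic (φ ▷ ψ) eq pq s = from (▷-pt φ ψ) λ t →
    ⊩-automorphic ψ (λ u∈ → eq (∈-++⁺ʳ (fv φ) u∈)) pq
      (to (▷-pt φ ψ) s (⊩-automorphic φ (λ u∈ → π-sym (eq (∈-++⁺ˡ u∈))) (π-sym pq) t))
  ⊩-automorphic (∀' x φ) {g} {h} eq pq s a _ = ⊩-automorphic φ eq′ pq (s (π a) tt)
    where
    eq′ : ∀ {u} → u ∈ fv φ → updA 𝔽 h x a u ≡ π (updA 𝔽 g x (π a) u)
    eq′ {u} u∈ with u ≟ x
    ... | yes refl = trans (if-≡ u) (trans (sym (π-involutive a)) (cong π (sym (if-≡ u))))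
    ... | no u≢x   = trans (if-≢ u≢x) (trans (eq (∈fv-∀ x φ u∈ u≢x)) (cong π (sym (if-≢ u≢x))))

module _ (em : ExcludedMiddle) where

  transpose : Obj → Obj → Obj → Obj
  transpose p q a with em (a ≡ p) | em (a ≡ q)
  ... | yes _ | _     = q
  ... | no _  | yes _ = p
  ... | no _  | no _  = a

  transpose-left : ∀ p q → transpose p q p ≡ q
  transpose-left p q with em (p ≡ p) | em (p ≡ q)
  ... | yes _ | _ = refl
  ... | no ≢p | _ = contradiction refl ≢p

  transpose-right : ∀ p q → transpose p q q ≡ p
  transpose-right p q with em (q ≡ p) | em (q ≡ q)
  ... | yes e | _     = e
  ... | no _  | yes _ = refl
  ... | no _  | no ≢q = contradiction refl ≢q

  transpose-other : ∀ {p q a} → a ≢ p → a ≢ q → transpose p q a ≡ a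
  transpose-other {p} {q} {a} ≢p ≢q with em (a ≡ p) | em (a ≡ q)
  ... | yes e | _     = contradiction e ≢p
  ... | no _  | yes e = contradiction e ≢q
  ... | no _  | no _  = refl

  transpose-involutive : ∀ p q a → transpose p q (transpose p q a) ≡ a
  transpose-involutive p q a = case em (a ≡ p) of λ where
    (yes refl) → trans (cong (transpose a q) (transpose-left a q)) (transpose-right a q)
    (no ≢p) → case em (a ≡ q) of λ where
      (yes refl) → trans (cong (transpose p a) (transpose-right p a)) (transpose-left p a)
      (no ≢q) → trans (cong (transpose p q) (transpose-other ≢p ≢q)) (transpose-other ≢p ≢q)

  -- Transposing `p` and `q` fixes all parameters once both have larger index than every value of
  -- `g` on the free variables.
  definable-eventuallyConstant : (φ : Fm L) (g : Var → Obj) → EventuallyConstant (_, g ⊩ φ)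
  definable-eventuallyConstant φ g = K , λ {p} {q} K≤p K≤q →
    ⊩-automorphic (transpose p q) (transpose-involutive p q) φ
      (λ u∈ → sym (transpose-other (small≢ K≤p u∈) (small≢ K≤q u∈)))
      (sym (transpose-left p q))
    where
    K : ℕ
    K = suc (maxL (map (index ∘ g) (fv φ)))
    small≢ : ∀ {p u} → K ≤ index p → u ∈ fv φ → g u ≢ p
    small≢ K≤p u∈ refl = 1+n≰n (≤-trans K≤p (∈⇒≤maxL (∈-map⁺ (index ∘ g) u∈)))

  -- Least elements of eventually constant sets

  minimum : (B : ℕ → Set) → ∀ n → B n → Σ ℕ λ m → B m × (∀ k → B k → m ≤ k)
  minimum B = <-rec _ λ n rec bn → case em (Σ ℕ λ m → m < n × B m) of λ where
    (yes (m , m<n , bm)) → rec m<n bm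
    (no none) → n , bn , λ k bk → ≮⇒≥ λ k<n → none (k , k<n , bk)

  maximum : (B : ℕ → Set) → ∀ bound → (∀ k → B k → k < bound) →
            ∀ n → B n → Σ ℕ λ m → B m × (∀ k → B k → k ≤ m)
  maximum B zero    B< n bn with () ← B< n bn
  maximum B (suc c) B< n bn = case em (B c) of λ where
    (yes bc) → c , bc , λ k bk → s≤s⁻¹ (B< k bk)
    (no ¬bc) → maximum B c (λ k bk → ≤∧≢⇒< (s≤s⁻¹ (B< k bk)) λ { refl → ¬bc bk }) n bn

  -- At `base`, the candidates are `base` itself, then the first near point in `X`. If `X` has no
  -- near point, a far point of index at least `K` would bring in `near K`; so the far indices are
  -- bounded, and the largest one is the lowest point.
  least-exists : ∀ {X w v} → EventuallyConstant X → w sees v → X v → Σ World (least X w)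
  least-exists {w = pt p} _ itself xv = pt p , itself , xv , λ { _ itself _ → ≼-refl }
  least-exists {X} {base} {v} (K , X-const) _ xv = case em (X base) of λ where
      (yes xb) → base , from-base , xb , λ _ _ _ → base≼
      (no ¬xb) → case em (Σ ℕ λ n → X (pt (near n))) of λ where
        (yes (n , xn)) → case minimum (X ∘ pt ∘ near) n xn of λ where
          (m , xm , m-min) → pt (near m) , from-base , xm , λ where
            base _ xb → contradiction xb ¬xb
            (pt (near k)) _ xk → near≼near (m-min k xk)
            (pt (far k)) _ _ → near≼far
        (no ¬near) → farthest ¬xb (λ n xn → ¬near (n , xn)) v xv
    where
    farthest : ¬ X base → (∀ n → ¬ X (pt (near n))) → ∀ v → X v → Σ World (least X base)
    farthest ¬xb ¬near base xb = contradiction xb ¬xb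
    farthest ¬xb ¬near (pt (near n)) xn = contradiction xn (¬near n)
    farthest ¬xb ¬near (pt (far n)) xn
      with m , xm , m-max ← maximum (X ∘ pt ∘ far) K
             (λ k xk → ≰⇒> λ K≤k → ¬near K (X-const {far k} {near K} K≤k ≤-refl xk)) n xn
      = pt (far m) , from-base , xm , λ where
          base _ xb → contradiction xb ¬xb
          (pt (near k)) _ xk → contradiction xk (¬near k)
          (pt (far k)) _ xk → far≼far (m-max k xk)

  -- Soundness in the countermodel

  ∧-elim : ∀ {B C : Set} → ¬ (B → ¬ C) → B × C
  ∧-elim {B} {C} h = decidable-stable (em (B × C)) λ ¬bc → h λ b c → ¬bc (b , c)

  inst-reflects : ∀ w g (s : ℕ → Fm L) p →
                  Reflects (w , g ⊩ inst s p) (evalP (λ i → does (em (w , g ⊩ s i))) p)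
  inst-reflects w g s (atom i)   = proof (em (w , g ⊩ s i))
  inst-reflects w g s (pneg p)   = ¬-reflects (inst-reflects w g s p)
  inst-reflects w g s (pimp p q) = inst-reflects w g s p →-reflects inst-reflects w g s q

  ⋀-▷ : ∀ {w v g} (φ ψ : Fm L) ψs → least (_, g ⊩ φ) w v →
        w , g ⊩ ⋀⁺ (φ ▷ ψ) (map (φ ▷_) ψs) → v , g ⊩ ⋀⁺ ψ ψs
  ⋀-▷ φ ψ []        lv h = h _ lv
  ⋀-▷ φ ψ (ψ′ ∷ ψs) lv h with h₁ , h₂ ← ∧-elim h = λ k → k (h₁ _ lv) (⋀-▷ φ ψ′ ψs lv h₂)

  -- As `y` is not free in the prefix, changing its value leaves each selection alone, so the
  -- quantifier moves inward one antecedent at a time.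
  generalise : ∀ {w g} αs x y (φ : Fm L) → All (λ α → y ∉ fv α) αs → y ∉ fv (∀' x φ) →
               (∀ a → w , updA 𝔽 g y a ⊩ αs ▷* (Ex L y ⊃ φ [ y / x ])) →
               w , g ⊩ αs ▷* ∀' x φ
  generalise {L} {w} {g} [] x y φ [] y∉ h a _ =
    to (sat-sub 𝔽 𝕀 φ eq w) (h a (sat-Ex 𝔽 𝕀 L y tt))
    where
    eq : ∀ {u} → u ∈ fv φ → updA 𝔽 g x a u ≡ updA 𝔽 g y a (upd (λ v → v) x y u)
    eq {u} u∈ with u ≟ x
    ... | yes refl = trans (if-≡ u) (sym (trans (cong (updA 𝔽 g y a) (if-≡ u)) (if-≡ y)))
    ... | no u≢x   = trans (if-≢ u≢x) (sym (trans (cong (updA 𝔽 g y a) (if-≢ u≢x))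
            (if-≢ {u = u} {y} λ { refl → y∉ (∈fv-∀ x φ u∈ u≢x) })))
  generalise {w = w} (α ∷ αs) x y φ (y∉α ∷ y∉αs) y∉ h v lv =
    generalise αs x y φ y∉αs y∉ λ a →
      h a v (to (Frame.f-ext 𝔽 _ _ w (sat-updA-fresh 𝔽 𝕀 α y∉α) v) lv)

  sound : ∀ {φ : Fm L} → Thm L k φ → ∀ w g → w , g ⊩ φ
  sound (A1 p s taut) w g =
    invert (subst (Reflects _) (taut _) (inst-reflects w g s p))
  sound (A2 φ) w g v (_ , xv , _) = xv
  -- `v` is the least ψ-world. Definability supplies a least φ-world `u`; the two conditionals make
  -- each a competitor of the other, so they coincide.
  sound (A3 φ ψ χ) w g h v lv@(wv , _ , v-min)
    with h₁ , φ▷χ ← ∧-elim h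
    with φ▷ψ , ψ▷φ ← ∧-elim h₁
    with u , lu@(wu , _ , u-min) ← least-exists (definable-eventuallyConstant φ g) wv (ψ▷φ v lv)
    with refl ← ≼-antisym (u-min v wv (ψ▷φ v lv)) (v-min u wu (φ▷ψ u lu))
    = φ▷χ u lu
  sound (A4 φ ψ) w g h xw = h w (sees-refl , xw , λ _ wu _ → sees⇒≼ wu)
  -- Least elements are unique, so one selected ψ-world settles the whole selection.
  sound (A5 φ ψ) w g ¬φ▷ψ v (wv , xv , v-min) yv = ¬φ▷ψ λ where
    u (wu , xu , u-min) → subst (_, g ⊩ ψ) (≼-antisym (v-min u wu xu) (u-min v wv xv)) yv
  sound (A6v x y φ) w g h = from (sat-sub 𝔽 𝕀 φ eq w) (proj₁ (∧-elim h) (g y) tt)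
    where
    eq : ∀ {u} → u ∈ fv φ → updA 𝔽 g x (g y) u ≡ g (upd (λ v → v) x y u)
    eq {u} _ with u ≡ᵇ x
    ... | true  = refl
    ... | false = refl
  sound (A7 x φ ψ x∉) w g h v lv a _ =
    h a tt v (to (Frame.f-ext 𝔽 _ _ w (sat-updA-fresh 𝔽 𝕀 φ x∉) v) lv)
  sound (R1 ⊢φ ⊢φ⊃ψ) w g = sound ⊢φ⊃ψ w g (sound ⊢φ w g)
  sound (R2 φ ψ ψs χ ⊢χ) w g h v lv = sound ⊢χ v g (⋀-▷ φ ψ ψs lv h)
  sound (R3v ψ αs x y φ y∉αs y∉ψ y∉ ⊢) w g h =
    generalise αs x y φ y∉αs y∉ λ a →
      sound ⊢ w (updA 𝔽 g y a) (to (sat-updA-fresh 𝔽 𝕀 ψ y∉ψ w) h)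
  sound {L} (C1 x) w g _ v (_ , ¬ex , _) = contradiction (sat-Ex 𝔽 𝕀 L x tt) ¬ex
  sound {L} (C2 x) w g ¬ex = contradiction (sat-Ex 𝔽 𝕀 L x tt) ¬ex
  sound (I1 x) w g = refl
  sound (I2 x y φ) w g x≡y h = h (from φ[y/x]⇔φ) (to φ[y/x]⇔φ)
    where
    eq : ∀ {u} → u ∈ fv φ → g u ≡ g (upd (λ v → v) x y u)
    eq {u} _ with u ≟ x
    ... | yes refl = trans x≡y (cong g (sym (if-≡ u)))
    ... | no u≢x   = cong g (sym (if-≢ u≢x))
    φ[y/x]⇔φ = sat-sub 𝔽 𝕀 φ eq w
  sound (I3 x y) w g x≢y v (_ , ¬¬x≡y , _) = contradiction x≢y ¬¬x≡y

theorem5p3 : ExcludedMiddle → (ℓ ℓ' : Level) (L : Lang) (k : Variant) →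
    ¬ Σ (FrameClass ℓ ℓ') (λ C → IsLogicOf L k C)
theorem5p3 em ℓ ℓ' L k (C , logic) =
  noDescent-fails {L} (λ _ → near 0)
    (sound em (from (logic noDescent) (IsLogicOf⇒noDescent-valid em logic)) base (λ _ → near 0))
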